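{- $\{(r_0,r_1)\in\mathbb{R}^2 \mid r_0-r_1<-1,\ r_0\ge 0\}\subset\mathcal{D}_2^{(*)}$.
   Context: For $\mathbf{r}=(r_0,r_1)\in\mathbb{R}^2$, the two-dimensional shift radix system is the map $\tau_{\mathbf{r}}:\mathbb{Z}^2\to\mathbb{Z}^2$, $\tau_{\mathbf{r}}(a_0,a_1)=(a_1,-\lfloor r_0a_0+r_1a_1\rfloor)$. The orbit of $(a_0,a_1)$ is identified with the integer sequence $(a_n)_{n\ge 0}$ where $a_{n+2}=-\lfloor r_0a_n+r_1a_{n+1}\rfloor$ for $n\ge0$. An orbit is ultimately periodic if there are $n_0\ge 0$, $p>0$ with $a_{n+p}=a_n$ for all $n\ge n_0$; it ends up in the trivial cycle if $a_n=0$ for all sufficiently large $n$. $\mathcal{D}_2^{(*)}$ is the set of all $\mathbf{r}\in\mathbb{R}^2$ such that each ultimately periodic orbit of $\tau_{\mathbf{r}}$ ends up in the trivial cycle. -}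

module Defs where

open import Data.Integer as ℤ using (ℤ; +_; 0ℤ; 1ℤ)
import Data.Integer.Properties as ℤ
open import Data.Nat as ℕ using (ℕ)
import Data.Nat.Properties as ℕ
open import Data.Product using (_×_; _,_; ∃; ∃-syntax)
open import Data.Rational as ℚ using (ℚ; 0ℚ; 1ℚ; ½)
import Data.Rational.Properties as ℚ
open import Data.Rational.Solver using (module +-*-Solver)
import Data.Rational.Unnormalised as ℚᵘ
import Data.Rational.Unnormalised.Properties as ℚᵘ
open import Data.Sum using (inj₁; inj₂)
open import Level using (0ℓ)
open import Relation.Binary.Definitions using (tri<; tri≈; tri>)
open import Relation.Binary.PropositionalEquality
  using (_≡_; refl; sym; trans; cong; cong₂; subst; subst₂)
open import Relation.Nullary using (¬_; contradiction)
open import Relation.Unary using (Pred)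

-- Real numbers: Cauchy sequences of rationals with modulus.  Distinct
-- sequences may represent the same real; _<_ and _≤_ depend only on the
-- real represented.

IsCauchy : (ℕ → ℚ) → Set
IsCauchy s = ∀ ε → 0ℚ ℚ.< ε →
  ∃[ N ] (∀ m n → N ℕ.≤ m → N ℕ.≤ n → ℚ.∣ s m ℚ.- s n ∣ ℚ.< ε)

record ℝ : Set where
  field
    seq    : ℕ → ℚ
    cauchy : IsCauchy seq

open ℝ public

abstract

  half : ∀ ε → ε ℚ.* ½ ℚ.+ ε ℚ.* ½ ≡ ε
  half ε = trans (sym (ℚ.*-distribˡ-+ ε ½ ½)) (ℚ.*-identityʳ ε)

  half-pos : ∀ {ε} → 0ℚ ℚ.< ε → 0ℚ ℚ.< ε ℚ.* ½
  half-pos 0<ε = ℚ.*-monoˡ-<-pos ½ 0<ε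

  +-cauchy : ∀ {s t} → IsCauchy s → IsCauchy t → IsCauchy (λ n → s n ℚ.+ t n)
  +-cauchy {s} {t} cs ct ε 0<ε
    with cs (ε ℚ.* ½) (half-pos 0<ε) | ct (ε ℚ.* ½) (half-pos 0<ε)
  ... | M , f | N , g = M ℕ.⊔ N , λ m n p q → begin-strict
    ℚ.∣ (s m ℚ.+ t m) ℚ.- (s n ℚ.+ t n) ∣
      ≡⟨ cong ℚ.∣_∣ (rearrange (s m) (t m) (s n) (t n)) ⟩
    ℚ.∣ (s m ℚ.- s n) ℚ.+ (t m ℚ.- t n) ∣
      ≤⟨ ℚ.∣p+q∣≤∣p∣+∣q∣ (s m ℚ.- s n) (t m ℚ.- t n) ⟩
    ℚ.∣ s m ℚ.- s n ∣ ℚ.+ ℚ.∣ t m ℚ.- t n ∣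
      <⟨ ℚ.+-mono-< (f m n (ℕ.m⊔n≤o⇒m≤o M N p) (ℕ.m⊔n≤o⇒m≤o M N q))
                    (g m n (ℕ.m⊔n≤o⇒n≤o M N p) (ℕ.m⊔n≤o⇒n≤o M N q)) ⟩
    ε ℚ.* ½ ℚ.+ ε ℚ.* ½
      ≡⟨ half ε ⟩
    ε ∎
    where
    open ℚ.≤-Reasoning
    open +-*-Solver
    rearrange : ∀ a b c d →
      (a ℚ.+ b) ℚ.- (c ℚ.+ d) ≡ (a ℚ.- c) ℚ.+ (b ℚ.- d)
    rearrange = solve 4 (λ a b c d →
      (a :+ b) :- (c :+ d) := (a :- c) :+ (b :- d)) refl

  neg-cauchy : ∀ {s} → IsCauchy s → IsCauchy (λ n → ℚ.- s n)
  neg-cauchy {s} cs ε 0<ε with cs ε 0<ε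
  ... | N , f = N , λ m n p q → subst (ℚ._< ε)
    (trans (sym (ℚ.∣-p∣≡∣p∣ (s m ℚ.- s n)))
           (cong ℚ.∣_∣ (ℚ.neg-distrib-+ (s m) (ℚ.- s n)))) (f m n p q)

  bounded : ∀ {s} → IsCauchy s →
    ∃[ N ] ∃[ B ] 0ℚ ℚ.< B × (∀ n → N ℕ.≤ n → ℚ.∣ s n ∣ ℚ.≤ B)
  bounded {s} cs with cs 1ℚ (ℚ.positive⁻¹ 1ℚ)
  ... | N , f = N , 1ℚ ℚ.+ ℚ.∣ s N ∣
    , ℚ.+-mono-<-≤ (ℚ.positive⁻¹ 1ℚ) (ℚ.0≤∣p∣ (s N))
    , λ n p → begin
    ℚ.∣ s n ∣
      ≡⟨ cong ℚ.∣_∣ (split (s n) (s N)) ⟩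
    ℚ.∣ (s n ℚ.- s N) ℚ.+ s N ∣
      ≤⟨ ℚ.∣p+q∣≤∣p∣+∣q∣ (s n ℚ.- s N) (s N) ⟩
    ℚ.∣ s n ℚ.- s N ∣ ℚ.+ ℚ.∣ s N ∣
      ≤⟨ ℚ.+-monoˡ-≤ ℚ.∣ s N ∣ (ℚ.<⇒≤ (f n N p ℕ.≤-refl)) ⟩
    1ℚ ℚ.+ ℚ.∣ s N ∣ ∎
    where
    open ℚ.≤-Reasoning
    open +-*-Solver
    split : ∀ a b → a ≡ (a ℚ.- b) ℚ.+ b
    split = solve 2 (λ a b → a := (a :- b) :+ b) refl

  *-term₁ : ∀ B δ a b → 0ℚ ℚ.< B → ℚ.∣ a ∣ ℚ.≤ B → ℚ.∣ b ∣ ℚ.< δ →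
            ℚ.∣ a ℚ.* b ∣ ℚ.< B ℚ.* δ
  *-term₁ B δ a b 0<B a≤B b<δ = begin-strict
    ℚ.∣ a ℚ.* b ∣         ≡⟨ ℚ.∣p*q∣≡∣p∣*∣q∣ a b ⟩
    ℚ.∣ a ∣ ℚ.* ℚ.∣ b ∣   ≤⟨ ℚ.*-monoʳ-≤-nonNeg ℚ.∣ b ∣ {{ℚ.∣-∣-nonNeg b}} a≤B ⟩
    B ℚ.* ℚ.∣ b ∣         <⟨ ℚ.*-monoʳ-<-pos B {{ℚ.positive 0<B}} b<δ ⟩
    B ℚ.* δ               ∎
    where open ℚ.≤-Reasoning

  *-term₂ : ∀ C δ a b → 0ℚ ℚ.< C → ℚ.∣ a ∣ ℚ.< δ → ℚ.∣ b ∣ ℚ.≤ C →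
            ℚ.∣ a ℚ.* b ∣ ℚ.< δ ℚ.* C
  *-term₂ C δ a b 0<C a<δ b≤C =
    subst₂ ℚ._<_ (cong ℚ.∣_∣ (ℚ.*-comm b a)) (ℚ.*-comm C δ)
      (*-term₁ C δ b a 0<C b≤C a<δ)

  *-split : ∀ a b c d →
    a ℚ.* b ℚ.- c ℚ.* d ≡ a ℚ.* (b ℚ.- d) ℚ.+ (a ℚ.- c) ℚ.* d
  *-split = solve 4 (λ a b c d →
    a :* b :- c :* d := a :* (b :- d) :+ (a :- c) :* d) refl
    where open +-*-Solver

  *-collect : ∀ b c e i →
    b ℚ.* (e ℚ.* i) ℚ.+ (e ℚ.* i) ℚ.* c ≡ e ℚ.* ((b ℚ.+ c) ℚ.* i)
  *-collect = solve 4 (λ b c e i →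
    b :* (e :* i) :+ (e :* i) :* c := e :* ((b :+ c) :* i)) refl
    where open +-*-Solver

  reciprocal : ∀ d → 0ℚ ℚ.< d → ∃[ i ] 0ℚ ℚ.< i × d ℚ.* i ≡ 1ℚ
  reciprocal d 0<d = ℚ.1/ d , ℚ.positive⁻¹ (ℚ.1/ d) , ℚ.*-inverseʳ d
    where
    instance
      d-pos : ℚ.Positive d
      d-pos = ℚ.positive 0<d

      d-nonZero : ℚ.NonZero d
      d-nonZero = ℚ.pos⇒nonZero d

      1/d-pos : ℚ.Positive (ℚ.1/ d)
      1/d-pos = ℚ.1/pos⇒pos d

  *-tolerance : ∀ B C ε → 0ℚ ℚ.< B → 0ℚ ℚ.< C → 0ℚ ℚ.< ε →
    ∃[ δ ] 0ℚ ℚ.< δ × B ℚ.* δ ℚ.+ δ ℚ.* C ≡ ε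
  *-tolerance B C ε 0<B 0<C 0<ε with reciprocal (B ℚ.+ C) (ℚ.+-mono-< 0<B 0<C)
  ... | i , 0<i , Di≡1 = ε ℚ.* i
    , subst (ℚ._< ε ℚ.* i) (ℚ.*-zeroˡ i) (ℚ.*-monoˡ-<-pos i {{ℚ.positive 0<i}} 0<ε)
    , trans (*-collect B C ε i)
        (trans (cong (ε ℚ.*_) Di≡1) (ℚ.*-identityʳ ε))

  *-close : ∀ {B C δ ε} → 0ℚ ℚ.< B → 0ℚ ℚ.< C → B ℚ.* δ ℚ.+ δ ℚ.* C ≡ ε →
    ∀ a b c d → ℚ.∣ a ∣ ℚ.≤ B → ℚ.∣ b ℚ.- d ∣ ℚ.< δ →
    ℚ.∣ a ℚ.- c ∣ ℚ.< δ → ℚ.∣ d ∣ ℚ.≤ C →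
    ℚ.∣ a ℚ.* b ℚ.- c ℚ.* d ∣ ℚ.< ε
  *-close {B} {C} {δ} {ε} 0<B 0<C total a b c d a≤B b-d<δ a-c<δ d≤C =
    begin-strict
    ℚ.∣ a ℚ.* b ℚ.- c ℚ.* d ∣
      ≡⟨ cong ℚ.∣_∣ (*-split a b c d) ⟩
    ℚ.∣ a ℚ.* (b ℚ.- d) ℚ.+ (a ℚ.- c) ℚ.* d ∣
      ≤⟨ ℚ.∣p+q∣≤∣p∣+∣q∣ (a ℚ.* (b ℚ.- d)) ((a ℚ.- c) ℚ.* d) ⟩
    ℚ.∣ a ℚ.* (b ℚ.- d) ∣ ℚ.+ ℚ.∣ (a ℚ.- c) ℚ.* d ∣
      <⟨ ℚ.+-mono-< (*-term₁ B δ a (b ℚ.- d) 0<B a≤B b-d<δ)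
                    (*-term₂ C δ (a ℚ.- c) d 0<C a-c<δ d≤C) ⟩
    B ℚ.* δ ℚ.+ δ ℚ.* C
      ≡⟨ total ⟩
    ε ∎
    where open ℚ.≤-Reasoning

  *-cauchy : ∀ {s t} → IsCauchy s → IsCauchy t → IsCauchy (λ n → s n ℚ.* t n)
  *-cauchy {s} {t} cs ct ε 0<ε =
    let K , B , 0<B , bs = bounded {s} cs
        L , C , 0<C , bt = bounded {t} ct
        δ , 0<δ , total  = *-tolerance B C ε 0<B 0<C 0<ε
        M , f            = cs δ 0<δ
        N , g            = ct δ 0<δ
    in (K ℕ.⊔ L) ℕ.⊔ (M ℕ.⊔ N) , λ m n p q →
    let p₁ = ℕ.m⊔n≤o⇒m≤o (K ℕ.⊔ L) (M ℕ.⊔ N) p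
        p₂ = ℕ.m⊔n≤o⇒n≤o (K ℕ.⊔ L) (M ℕ.⊔ N) p
        q₁ = ℕ.m⊔n≤o⇒m≤o (K ℕ.⊔ L) (M ℕ.⊔ N) q
        q₂ = ℕ.m⊔n≤o⇒n≤o (K ℕ.⊔ L) (M ℕ.⊔ N) q
    in *-close 0<B 0<C total (s m) (t m) (s n) (t n)
         (bs m (ℕ.m⊔n≤o⇒m≤o K L p₁))
         (g m n (ℕ.m⊔n≤o⇒n≤o M N p₂) (ℕ.m⊔n≤o⇒n≤o M N q₂))
         (f m n (ℕ.m⊔n≤o⇒m≤o M N p₂) (ℕ.m⊔n≤o⇒m≤o M N q₂))
         (bt n (ℕ.m⊔n≤o⇒n≤o K L q₁))

  const-cauchy : ∀ q → IsCauchy (λ _ → q)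
  const-cauchy q ε 0<ε = 0 , λ _ _ _ _ →
    subst (ℚ._< ε) (sym (cong ℚ.∣_∣ (ℚ.+-inverseʳ q))) 0<ε

infix  4 _<_ _≤_ _≥_
infixl 6 _+_ _-_
infixl 7 _*_
infix  8 -_

_+_ : ℝ → ℝ → ℝ
x + y = record
  { seq    = λ n → seq x n ℚ.+ seq y n
  ; cauchy = +-cauchy {seq x} {seq y} (cauchy x) (cauchy y)
  }

_*_ : ℝ → ℝ → ℝ
x * y = record
  { seq    = λ n → seq x n ℚ.* seq y n
  ; cauchy = *-cauchy {seq x} {seq y} (cauchy x) (cauchy y)
  }

-_ : ℝ → ℝ
- x = record
  { seq    = λ n → ℚ.- seq x n
  ; cauchy = neg-cauchy {seq x} (cauchy x)
  }

_-_ : ℝ → ℝ → ℝ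
x - y = x + (- y)

fromℚ : ℚ → ℝ
fromℚ q = record { seq = λ _ → q ; cauchy = const-cauchy q }

fromℤ : ℤ → ℝ
fromℤ k = fromℚ (k ℚ./ 1)

0ℝ 1ℝ : ℝ
0ℝ = fromℤ 0ℤ
1ℝ = fromℤ 1ℤ

_<_ : ℝ → ℝ → Set
x < y = ∃[ ε ] 0ℚ ℚ.< ε ×
  (∃[ N ] (∀ n → N ℕ.≤ n → seq x n ℚ.+ ε ℚ.≤ seq y n))

_≤_ : ℝ → ℝ → Set
x ≤ y = ¬ (y < x)

_≥_ : ℝ → ℝ → Set
x ≥ y = y ≤ x

-- Floor.  There is no constructive floor function on ℝ, so the floor is
-- given by its graph: IsFloor k x says k = ⌊x⌋.  The lemmas below show
-- that every real has exactly one floor, existence being classical.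

IsFloor : ℤ → ℝ → Set
IsFloor k x = fromℤ k ≤ x × x < fromℤ k + 1ℝ

abstract

  /1-≃ : ∀ i → ℚ.toℚᵘ (i ℚ./ 1) ℚᵘ.≃ ℚᵘ.mkℚᵘ i 0
  /1-≃ i = ℚ.toℚᵘ-fromℚᵘ (ℚᵘ.mkℚᵘ i 0)

  /1-mono-≤ : ∀ {i j} → i ℤ.≤ j → i ℚ./ 1 ℚ.≤ j ℚ./ 1
  /1-mono-≤ {i} {j} i≤j = ℚ.toℚᵘ-cancel-≤
    (ℚᵘ.≤-respˡ-≃ (ℚᵘ.≃-sym (/1-≃ i))
      (ℚᵘ.≤-respʳ-≃ (ℚᵘ.≃-sym (/1-≃ j))
        (ℚᵘ.*≤* (ℤ.*-monoʳ-≤-nonNeg 1ℤ i≤j))))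

  /1-homo-+ : ∀ i j → (i ℤ.+ j) ℚ./ 1 ≡ i ℚ./ 1 ℚ.+ j ℚ./ 1
  /1-homo-+ i j = ℚ.toℚᵘ-injective (begin
    ℚ.toℚᵘ ((i ℤ.+ j) ℚ./ 1)
      ≈⟨ /1-≃ (i ℤ.+ j) ⟩
    ℚᵘ.mkℚᵘ (i ℤ.+ j) 0
      ≈⟨ ℚᵘ.*≡* (cong (ℤ._* 1ℤ)
           (cong₂ ℤ._+_ (sym (ℤ.*-identityʳ i)) (sym (ℤ.*-identityʳ j)))) ⟩
    ℚᵘ.mkℚᵘ i 0 ℚᵘ.+ ℚᵘ.mkℚᵘ j 0
      ≈⟨ ℚᵘ.+-cong (/1-≃ i) (/1-≃ j) ⟨
    ℚ.toℚᵘ (i ℚ./ 1) ℚᵘ.+ ℚ.toℚᵘ (j ℚ./ 1)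
      ≈⟨ ℚ.toℚᵘ-homo-+ (i ℚ./ 1) (j ℚ./ 1) ⟨
    ℚ.toℚᵘ (i ℚ./ 1 ℚ.+ j ℚ./ 1) ∎)
    where open ℚᵘ.≃-Reasoning

  /1-neg : ∀ i → (ℤ.- i) ℚ./ 1 ≡ ℚ.- (i ℚ./ 1)
  /1-neg i = ℚ.toℚᵘ-injective (begin
    ℚ.toℚᵘ ((ℤ.- i) ℚ./ 1)   ≈⟨ /1-≃ (ℤ.- i) ⟩
    ℚᵘ.- ℚᵘ.mkℚᵘ i 0         ≈⟨ ℚᵘ.-‿cong (/1-≃ i) ⟨
    ℚᵘ.- ℚ.toℚᵘ (i ℚ./ 1)    ≈⟨ ℚ.toℚᵘ-homo‿- (i ℚ./ 1) ⟨
    ℚ.toℚᵘ (ℚ.- (i ℚ./ 1))   ∎)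
    where open ℚᵘ.≃-Reasoning

  archimedean : ∀ q → ∃[ m ] q ℚ.≤ + m ℚ./ 1
  archimedean q@(ℚ.mkℚ n d-1 _) = ℤ.∣ n ∣ , ℚ.toℚᵘ-cancel-≤
    (ℚᵘ.≤-respʳ-≃ (ℚᵘ.≃-sym (/1-≃ (+ ℤ.∣ n ∣))) (ℚᵘ.*≤* (n≤∣n∣*d n)))
    where
    n≤∣n∣*d : ∀ i → i ℤ.* 1ℤ ℤ.≤ + ℤ.∣ i ∣ ℤ.* + ℕ.suc d-1
    n≤∣n∣*d (+ k) = subst₂ ℤ._≤_
      (sym (ℤ.*-identityʳ (+ k))) (ℤ.pos-* k (ℕ.suc d-1))
      (ℤ.+≤+ (ℕ.m≤m*n k (ℕ.suc d-1)))
    n≤∣n∣*d ℤ.-[1+ k ] = ℤ.-≤+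

  fromℤ-mono : ∀ x {i j} → i ℤ.≤ j → x < fromℤ i → x < fromℤ j
  fromℤ-mono x i≤j (ε , 0<ε , N , f) =
    ε , 0<ε , N , λ n p → ℚ.≤-trans (f n p) (/1-mono-≤ i≤j)

  <-suc : ∀ x k → x < fromℤ (k ℤ.+ 1ℤ) → x < fromℤ k + 1ℝ
  <-suc x k (ε , 0<ε , N , f) = ε , 0<ε , N , λ n p →
    subst (seq x n ℚ.+ ε ℚ.≤_) (/1-homo-+ k 1ℤ) (f n p)

  <-suc⁻¹ : ∀ x k → x < fromℤ k + 1ℝ → x < fromℤ (k ℤ.+ 1ℤ)
  <-suc⁻¹ x k (ε , 0<ε , N , f) = ε , 0<ε , N , λ n p →
    subst (seq x n ℚ.+ ε ℚ.≤_) (sym (/1-homo-+ k 1ℤ)) (f n p)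

  suc-≤ : ∀ {i j} → i ℤ.< j → i ℤ.+ 1ℤ ℤ.≤ j
  suc-≤ {i} {j} i<j = subst (ℤ._≤ j) (ℤ.+-comm 1ℤ i) (ℤ.i<j⇒suc[i]≤j i<j)

isFloor-unique : ∀ {k l} x → IsFloor k x → IsFloor l x → k ≡ l
isFloor-unique {k} {l} x (k≤x , x<k+1) (l≤x , x<l+1) with ℤ.<-cmp k l
... | tri≈ _ k≡l _ = k≡l
... | tri< k<l _ _ =
  contradiction (fromℤ-mono x (suc-≤ k<l) (<-suc⁻¹ x k x<k+1)) l≤x
... | tri> _ _ l<k =
  contradiction (fromℤ-mono x (suc-≤ l<k) (<-suc⁻¹ x l x<l+1)) k≤x

abstract

  floor-search : ∀ x d j → fromℤ j ≤ x → x < fromℤ (j ℤ.+ + d) →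
    ¬ ¬ (∃[ k ] IsFloor k x)
  floor-search x ℕ.zero j j≤x x<j _ =
    j≤x (subst (λ i → x < fromℤ i) (ℤ.+-identityʳ j) x<j)
  floor-search x (ℕ.suc d) j j≤x x<j+d none = floor-search x d (j ℤ.+ 1ℤ)
    (λ x<j+1 → none (j , j≤x , <-suc x j x<j+1))
    (subst (λ i → x < fromℤ i) (sym (ℤ.+-assoc j 1ℤ (+ d))) x<j+d)
    none

  p≤∣p∣ : ∀ p → p ℚ.≤ ℚ.∣ p ∣
  p≤∣p∣ p with ℚ.≤-total 0ℚ p
  ... | inj₁ 0≤p = ℚ.≤-reflexive (sym (ℚ.0≤p⇒∣p∣≡p 0≤p))
  ... | inj₂ p≤0 = ℚ.≤-trans p≤0 (ℚ.0≤∣p∣ p)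

  neg-neg : ∀ p → ℚ.- (ℚ.- p) ≡ p
  neg-neg = solve 1 (λ p → :- (:- p) := p) refl
    where open +-*-Solver

  ∣p∣≤q⇒-q≤p : ∀ {p q} → ℚ.∣ p ∣ ℚ.≤ q → ℚ.- q ℚ.≤ p
  ∣p∣≤q⇒-q≤p {p} {q} ∣p∣≤q = subst (ℚ.- q ℚ.≤_) (neg-neg p)
    (ℚ.neg-antimono-≤ (ℚ.≤-trans
      (subst (ℚ.- p ℚ.≤_) (ℚ.∣-p∣≡∣p∣ p) (p≤∣p∣ (ℚ.- p))) ∣p∣≤q))

  lower-bound : ∀ x N m → (∀ n → N ℕ.≤ n → ℚ.∣ seq x n ∣ ℚ.≤ + m ℚ./ 1) →
    fromℤ (ℤ.- + m) ≤ x
  lower-bound x N m ∣x∣≤m (ε , 0<ε , K , f) = ℚ.<-irrefl refl (begin-strict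
    seq x n           ≡⟨ ℚ.+-identityʳ (seq x n) ⟨
    seq x n ℚ.+ 0ℚ    <⟨ ℚ.+-monoʳ-< (seq x n) 0<ε ⟩
    seq x n ℚ.+ ε     ≤⟨ f n (ℕ.m≤n⊔m N K) ⟩
    (ℤ.- + m) ℚ./ 1   ≡⟨ /1-neg (+ m) ⟩
    ℚ.- (+ m ℚ./ 1)   ≤⟨ ∣p∣≤q⇒-q≤p (∣x∣≤m n (ℕ.m≤m⊔n N K)) ⟩
    seq x n           ∎)
    where
    open ℚ.≤-Reasoning
    n : ℕ
    n = N ℕ.⊔ K

  upper-bound : ∀ x N m → (∀ n → N ℕ.≤ n → ℚ.∣ seq x n ∣ ℚ.≤ + m ℚ./ 1) →
    x < fromℤ (+ m ℤ.+ 1ℤ)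
  upper-bound x N m ∣x∣≤m = 1ℚ , ℚ.positive⁻¹ 1ℚ , N , λ n p →
    subst (seq x n ℚ.+ 1ℚ ℚ.≤_) (sym (/1-homo-+ (+ m) 1ℤ))
      (ℚ.+-monoˡ-≤ 1ℚ (ℚ.≤-trans (p≤∣p∣ (seq x n)) (∣x∣≤m n p)))

isFloor-exists : ∀ x → ¬ ¬ (∃[ k ] IsFloor k x)
isFloor-exists x =
  let N , B , _ , ∣x∣≤B = bounded {seq x} (cauchy x)
      m , B≤m           = archimedean B
      ∣x∣≤m             = λ n p → ℚ.≤-trans (∣x∣≤B n p) B≤m
  in floor-search x (m ℕ.+ ℕ.suc m) (ℤ.- + m) (lower-bound x N m ∣x∣≤m)
       (subst (λ i → x < fromℤ i) (cancel m) (upper-bound x N m ∣x∣≤m))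
  where
  cancel : ∀ m → + m ℤ.+ 1ℤ ≡ ℤ.- + m ℤ.+ + (m ℕ.+ ℕ.suc m)
  cancel m = sym (trans (sym (ℤ.+-assoc (ℤ.- + m) (+ m) (+ ℕ.suc m)))
    (trans (cong (ℤ._+ + ℕ.suc m) (ℤ.+-inverseˡ (+ m)))
      (trans (ℤ.+-identityˡ (+ ℕ.suc m)) (ℤ.+-comm 1ℤ (+ m)))))

-- The graph of the map τ_r : ℤ² → ℤ².
τ[_]_↦_ : ℝ × ℝ → ℤ × ℤ → ℤ × ℤ → Set
τ[ r₀ , r₁ ] (a₀ , a₁) ↦ (b₀ , b₁) =
  b₀ ≡ a₁ ×
  (∃[ k ] IsFloor k (r₀ * fromℤ a₀ + r₁ * fromℤ a₁) × b₁ ≡ ℤ.- k)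

-- The sequence a encodes the orbit (a₀ , a₁), (a₁ , a₂), …
IsOrbit : ℝ × ℝ → (ℕ → ℤ) → Set
IsOrbit r a = ∀ n →
  τ[ r ] (a n , a (1 ℕ.+ n)) ↦ (a (1 ℕ.+ n) , a (2 ℕ.+ n))

UltimatelyPeriodic : (ℕ → ℤ) → Set
UltimatelyPeriodic a = ∃[ n₀ ] ∃[ p ] 0 ℕ.< p ×
  (∀ n → n₀ ℕ.≤ n → a (n ℕ.+ p) ≡ a n)

EndsInTrivialCycle : (ℕ → ℤ) → Set
EndsInTrivialCycle a = ∃[ n₀ ] (∀ n → n₀ ℕ.≤ n → a n ≡ 0ℤ)

𝒟₂⁽*⁾ : Pred (ℝ × ℝ) 0ℓ
𝒟₂⁽*⁾ r = ∀ a → IsOrbit r a → UltimatelyPeriodic a → EndsInTrivialCycle a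

{-# OPTIONS --safe #-}

-- The floor condition reads 0 ≤ r₀ a n + r₁ a (1+n) + a (2+n) < 1.  Since
-- r₁ > r₀ + 1, a term of the largest modulus M > 0 is followed by a term of
-- modulus at least M and of opposite sign, and strictly larger than M after
-- the value − M.  Hence the values ± M cannot occur past the first term of a
-- tail bounded by M, so such a tail is bounded by M − 1 after dropping one
-- term, and descent on M leaves the zero sequence.  Periodicity serves only
-- to provide the initial bound.
module Submission where

open import Defs
open import Data.Integer as ℤ using (ℤ; +_; -[1+_])
import Data.Integer.Properties as ℤ
open import Data.Nat as ℕ using (ℕ; zero; suc)
open import Data.Nat.Induction using (<-rec)
import Data.Nat.Properties as ℕ
open import Data.Product using (_×_; _,_; ∃-syntax)
open import Data.Rational as ℚ using (ℚ; 0ℚ; 1ℚ; ½)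
import Data.Rational.Properties as ℚ
open import Data.Rational.Solver using (module +-*-Solver)
open import Data.Sum using (inj₁; inj₂)
open import Relation.Binary.PropositionalEquality
  using (_≡_; _≢_; refl; sym; trans; cong; subst; subst₂)
open import Relation.Nullary using (yes; no; contradiction)
open import Relation.Unary using (_⊆_)

0≤q-p : ∀ {p q} → p ℚ.≤ q → 0ℚ ℚ.≤ q ℚ.- p
0≤q-p {p} {q} p≤q = subst (ℚ._≤ q ℚ.- p) (ℚ.+-inverseʳ p) (ℚ.+-monoˡ-≤ (ℚ.- p) p≤q)

0≤q-p⁻¹ : ∀ {p q} → 0ℚ ℚ.≤ q ℚ.- p → p ℚ.≤ q
0≤q-p⁻¹ {p} {q} 0≤q-p =
  subst₂ ℚ._≤_ (ℚ.+-identityˡ p) (cancel q p) (ℚ.+-monoˡ-≤ p 0≤q-p)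
  where
  open +-*-Solver
  cancel : ∀ q p → (q ℚ.- p) ℚ.+ p ≡ q
  cancel = solve 2 (λ q p → (q :- p) :+ p := q) refl

0≤p*q : ∀ {p q} → 0ℚ ℚ.≤ p → 0ℚ ℚ.≤ q → 0ℚ ℚ.≤ p ℚ.* q
0≤p*q {p} {q} 0≤p 0≤q = subst (ℚ._≤ p ℚ.* q) (ℚ.*-zeroˡ q)
  (ℚ.*-monoʳ-≤-nonNeg q {{ℚ.nonNegative 0≤q}} 0≤p)

∣i∣≤m⇒i≤m : ∀ i {m} → ℤ.∣ i ∣ ℕ.≤ m → i ℤ.≤ + m
∣i∣≤m⇒i≤m (+ _)     ∣i∣≤m = ℤ.+≤+ ∣i∣≤m
∣i∣≤m⇒i≤m -[1+ _ ] _     = ℤ.-≤+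

∣i∣≤m⇒-m≤i : ∀ i {m} → ℤ.∣ i ∣ ℕ.≤ m → ℤ.- + m ℤ.≤ i
∣i∣≤m⇒-m≤i i {m} ∣i∣≤m = subst (ℤ.- + m ℤ.≤_) (ℤ.neg-involutive i)
  (ℤ.neg-mono-≤ (∣i∣≤m⇒i≤m (ℤ.- i) (subst (ℕ._≤ m) (sym (ℤ.∣-i∣≡∣i∣ i)) ∣i∣≤m)))

-- Since `x ≥ 0ℝ` is a negation, the rational inequality is decided instead: one term below `- δ`,
-- past the Cauchy index for `δ / 2`, would keep all later terms below `- δ / 2`, and then `x < 0ℝ`.
≥0⇒eventually-≥-δ : ∀ x → x ≥ 0ℝ → ∀ {δ} → 0ℚ ℚ.< δ →
  ∃[ N ] (∀ n → N ℕ.≤ n → 0ℚ ℚ.≤ seq x n ℚ.+ δ)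
≥0⇒eventually-≥-δ x x≥0 {δ} 0<δ with cauchy x (δ ℚ.* ½) (half-pos 0<δ)
... | N , close = N , bound
  where
  open +-*-Solver
  rearrange : ∀ a b →
    (δ ℚ.* ½ ℚ.+ 0ℚ) ℚ.- ((a ℚ.- b) ℚ.+ (b ℚ.+ δ)) ≡ 0ℚ ℚ.- (a ℚ.+ δ ℚ.* ½)
  rearrange a b = solve 3 (λ a b δ →
    (δ :* con ½ :+ con 0ℚ) :- ((a :- b) :+ (b :+ δ)) := con 0ℚ :- (a :+ δ :* con ½))
    refl a b δ

  bound : ∀ n → N ℕ.≤ n → 0ℚ ℚ.≤ seq x n ℚ.+ δ
  bound n N≤n with 0ℚ ℚ.≤? seq x n ℚ.+ δ
  ... | yes p = p
  ... | no ¬p = contradiction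
    (δ ℚ.* ½ , half-pos 0<δ , N , λ m N≤m → 0≤q-p⁻¹ (subst (0ℚ ℚ.≤_)
      (rearrange (seq x m) (seq x n))
      (0≤q-p (ℚ.<⇒≤ (ℚ.+-mono-<
        (ℚ.≤-<-trans (p≤∣p∣ _) (close m n N≤m N≤n)) (ℚ.≰⇒> ¬p))))))
    x≥0

-- The difference of the two sides is
-- (p + δ)(M − x) + δ (x + M) + (− 1 − (p − q + ε)) M  with  δ = ε / 4.
linear-bound : ∀ {p q ε M x} → 0ℚ ℚ.≤ ε → 0ℚ ℚ.≤ p ℚ.+ ε ℚ.* ½ ℚ.* ½ →
  (p ℚ.- q) ℚ.+ ε ℚ.≤ ℚ.- 1ℚ → 0ℚ ℚ.≤ M → ℚ.- M ℚ.≤ x → x ℚ.≤ M →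
  p ℚ.* x ℚ.+ M ℚ.+ M ℚ.* (ε ℚ.* ½) ℚ.≤ q ℚ.* M
linear-bound {p} {q} {ε} {M} {x} 0≤ε 0≤p+δ p-q+ε≤-1 0≤M -M≤x x≤M =
  0≤q-p⁻¹ (subst (0ℚ ℚ.≤_) (identity p q ε M x)
    (ℚ.+-mono-≤ (ℚ.+-mono-≤
      (0≤p*q 0≤p+δ (0≤q-p x≤M))
      (0≤p*q (0≤p*q (0≤p*q 0≤ε 0≤½) 0≤½) (0≤q-p -M≤x)))
      (0≤p*q (0≤q-p p-q+ε≤-1) 0≤M)))
  where
  0≤½ : 0ℚ ℚ.≤ ½
  0≤½ = ℚ.nonNegative⁻¹ ½
  open +-*-Solver
  identity : ∀ p q ε M x →
    (p ℚ.+ ε ℚ.* ½ ℚ.* ½) ℚ.* (M ℚ.- x) ℚ.+ (ε ℚ.* ½ ℚ.* ½) ℚ.* (x ℚ.- (ℚ.- M))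
      ℚ.+ (ℚ.- 1ℚ ℚ.- ((p ℚ.- q) ℚ.+ ε)) ℚ.* M
    ≡ q ℚ.* M ℚ.- (p ℚ.* x ℚ.+ M ℚ.+ M ℚ.* (ε ℚ.* ½))
  identity = solve 5 (λ p q ε M x →
    (p :+ ε :* con ½ :* con ½) :* (M :- x) :+ (ε :* con ½ :* con ½) :* (x :- (:- M))
      :+ (:- con 1ℚ :- ((p :- q) :+ ε)) :* M
    := q :* M :- (p :* x :+ M :+ M :* (ε :* con ½))) refl

module _ {r₀ r₁ : ℝ} (r₀-r₁<-1 : r₀ - r₁ < - 1ℝ) (r₀≥0 : r₀ ≥ 0ℝ) where

  -- With `M = suc m`, real arithmetic gives `r₀ x + M ≤ (r₀ + 1) M < r₁ M`. This is its form for
  -- the rational approximations, with an explicit margin `η`.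
  r₁-dominates : ∀ m → ∃[ η ] 0ℚ ℚ.< η × (∃[ N ] (∀ n → N ℕ.≤ n →
    ∀ x → ℤ.∣ x ∣ ℕ.≤ suc m →
    seq r₀ n ℚ.* (x ℚ./ 1) ℚ.+ + suc m ℚ./ 1 ℚ.+ η ℚ.≤ seq r₁ n ℚ.* (+ suc m ℚ./ 1)))
  r₁-dominates m =
    let ε , 0<ε , K , gap = r₀-r₁<-1
        L , almost-≥0     = ≥0⇒eventually-≥-δ r₀ r₀≥0 (half-pos (half-pos 0<ε))
    -- The gap contributes `M ε`. Half of it pays for `r₀` being known only to be eventually at
    -- least `- ε / 4`, a loss multiplied by `M - x ≤ 2 M`; the other half remains as margin.
    in M ℚ.* (ε ℚ.* ½)
     , subst (ℚ._< M ℚ.* (ε ℚ.* ½)) (ℚ.*-zeroʳ M)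
         (ℚ.*-monoʳ-<-pos M {{ℚ.positive 0<M}} (half-pos 0<ε))
     , K ℕ.⊔ L , λ n N≤n x ∣x∣≤M →
         linear-bound {seq r₀ n} {seq r₁ n} {ε} {M} {x ℚ./ 1} (ℚ.<⇒≤ 0<ε)
           (almost-≥0 n (ℕ.m⊔n≤o⇒n≤o K L N≤n))
           (gap n (ℕ.m⊔n≤o⇒m≤o K L N≤n)) (ℚ.<⇒≤ 0<M)
           (subst (ℚ._≤ x ℚ./ 1) (/1-neg (+ suc m)) (/1-mono-≤ (∣i∣≤m⇒-m≤i x ∣x∣≤M)))
           (/1-mono-≤ (∣i∣≤m⇒i≤m x ∣x∣≤M))
    where
    M : ℚ
    M = + suc m ℚ./ 1
    0<M : 0ℚ ℚ.< M
    0<M = ℚ.<-≤-trans (ℚ.positive⁻¹ 1ℚ) (/1-mono-≤ {+ 1} {+ suc m} (ℤ.+≤+ (ℕ.s≤s ℕ.z≤n)))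

  -- By `r₁-dominates`, `r₀ x - r₁ M` lies strictly below `- M`, so its floor cannot reach `- M`.
  floor-neg : ∀ {m k} x → ℤ.∣ x ∣ ℕ.≤ suc m →
    IsFloor k (r₀ * fromℤ x + r₁ * fromℤ -[1+ m ]) → k ℤ.< -[1+ m ]
  floor-neg {m} {k} x ∣x∣≤M (k≤y , _) = ℤ.≰⇒> λ -M≤k →
    let η , 0<η , N , dom = r₁-dominates m
    in k≤y (fromℤ-mono (r₀ * fromℤ x + r₁ * fromℤ -[1+ m ]) -M≤k
      (η , 0<η , N , λ n N≤n → 0≤q-p⁻¹ (subst (0ℚ ℚ.≤_)
        (trans (identity (seq r₀ n) (seq r₁ n) (x ℚ./ 1) M η)
          (cong (λ z → z ℚ.- (seq r₀ n ℚ.* (x ℚ./ 1) ℚ.+ seq r₁ n ℚ.* z ℚ.+ η))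
            (sym (/1-neg (+ suc m)))))
        (0≤q-p (dom n N≤n x ∣x∣≤M)))))
    where
    M : ℚ
    M = + suc m ℚ./ 1
    open +-*-Solver
    identity : ∀ p q x M η →
      q ℚ.* M ℚ.- (p ℚ.* x ℚ.+ M ℚ.+ η) ≡ ℚ.- M ℚ.- (p ℚ.* x ℚ.+ q ℚ.* (ℚ.- M) ℚ.+ η)
    identity = solve 5 (λ p q x M η →
      q :* M :- (p :* x :+ M :+ η) := :- M :- (p :* x :+ q :* (:- M) :+ η)) refl

  -- By `r₁-dominates` at `- x`, the number `r₀ x + r₁ M` exceeds `M`. Its floor may still equal
  -- `M`, so the inequality is weak, unlike in `floor-neg`.
  floor-pos : ∀ {m k} x → ℤ.∣ x ∣ ℕ.≤ suc m →
    IsFloor k (r₀ * fromℤ x + r₁ * fromℤ (+ suc m)) → + suc m ℤ.≤ k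
  floor-pos {m} {k} x ∣x∣≤M (_ , y<k+1) = ℤ.≮⇒≥ λ k<M →
    let η , 0<η , N , dom = r₁-dominates m
        y                 = r₀ * fromℤ x + r₁ * fromℤ (+ suc m)
        -- From `k < M` follows `k + 1 ≤ M`, so the floor condition yields `y < M`.
        ε , 0<ε , K , gap = fromℤ-mono y (suc-≤ k<M) (<-suc⁻¹ y k y<k+1)
        n                 = N ℕ.⊔ K
        -- Adding the two estimates cancels the `r₀` terms and leaves `η + ε ≤ 0` up to a common
        -- summand.
        sum≤0             = subst₂ ℚ._≤_
          (trans (cong (λ z → seq r₀ n ℚ.* z ℚ.+ M ℚ.+ η
                              ℚ.+ (seq r₀ n ℚ.* (x ℚ./ 1) ℚ.+ seq r₁ n ℚ.* M ℚ.+ ε))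
                   (/1-neg x))
            (identity (seq r₀ n) (seq r₁ n) (x ℚ./ 1) M η ε))
          (ℚ.+-comm (seq r₁ n ℚ.* M) M)
          (ℚ.+-mono-≤ (dom n (ℕ.m≤m⊔n N K) (ℤ.- x)
              (subst (ℕ._≤ suc m) (sym (ℤ.∣-i∣≡∣i∣ x)) ∣x∣≤M))
            (gap n (ℕ.m≤n⊔m N K)))
    in ℚ.<-irrefl refl (ℚ.<-≤-trans
         (subst (ℚ._< (M ℚ.+ seq r₁ n ℚ.* M) ℚ.+ (η ℚ.+ ε))
           (ℚ.+-identityʳ (M ℚ.+ seq r₁ n ℚ.* M))
           (ℚ.+-monoʳ-< (M ℚ.+ seq r₁ n ℚ.* M) (ℚ.+-mono-< 0<η 0<ε)))
         sum≤0)
    where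
    M : ℚ
    M = + suc m ℚ./ 1
    open +-*-Solver
    identity : ∀ p q x M η ε →
      p ℚ.* (ℚ.- x) ℚ.+ M ℚ.+ η ℚ.+ (p ℚ.* x ℚ.+ q ℚ.* M ℚ.+ ε)
      ≡ (M ℚ.+ q ℚ.* M) ℚ.+ (η ℚ.+ ε)
    identity = solve 6 (λ p q x M η ε →
      p :* (:- x) :+ M :+ η :+ (p :* x :+ q :* M :+ ε)
      := (M :+ q :* M) :+ (η :+ ε)) refl

  step-neg : ∀ {m b c} x → ℤ.∣ x ∣ ℕ.≤ suc m →
    τ[ r₀ , r₁ ] (x , -[1+ m ]) ↦ (b , c) → suc m ℕ.< ℤ.∣ c ∣
  step-neg {m} x ∣x∣≤M (_ , k , isFloor , c≡-k) =
    subst (λ i → suc m ℕ.< ℤ.∣ i ∣) (sym c≡-k)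
      (subst (suc m ℕ.<_) (sym (ℤ.∣-i∣≡∣i∣ k)) (i<-M⇒M<∣i∣ (floor-neg {m} {k} x ∣x∣≤M isFloor)))
    where
    i<-M⇒M<∣i∣ : ∀ {i} → i ℤ.< -[1+ m ] → suc m ℕ.< ℤ.∣ i ∣
    i<-M⇒M<∣i∣ (ℤ.-<- m<j) = ℕ.s≤s m<j

  step-pos : ∀ {m b c} x → ℤ.∣ x ∣ ℕ.≤ suc m →
    τ[ r₀ , r₁ ] (x , + suc m) ↦ (b , c) → ℤ.∣ c ∣ ℕ.≤ suc m → c ≡ -[1+ m ]
  step-pos {m} x ∣x∣≤M (_ , k , isFloor , c≡-k) ∣c∣≤M = trans c≡-k (cong ℤ.-_
    (ℤ.≤-antisym (∣i∣≤m⇒i≤m k ∣k∣≤M) (floor-pos {m} {k} x ∣x∣≤M isFloor)))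
    where
    ∣k∣≤M : ℤ.∣ k ∣ ℕ.≤ suc m
    ∣k∣≤M = subst (ℕ._≤ suc m) (trans (cong ℤ.∣_∣ c≡-k) (ℤ.∣-i∣≡∣i∣ k)) ∣c∣≤M

  module _ {a : ℕ → ℤ} (orbit : IsOrbit (r₀ , r₁) a) where

    BoundedFrom : ℕ → ℕ → Set
    BoundedFrom N m = ∀ n → N ℕ.≤ n → ℤ.∣ a n ∣ ℕ.≤ m

    -- The variable `y` lets a known value of `a (1 + n)` take the constructor form that the step
    -- lemmas expect.
    orbit-at : ∀ n {y} → a (1 ℕ.+ n) ≡ y →
      τ[ r₀ , r₁ ] (a n , y) ↦ (a (1 ℕ.+ n) , a (2 ℕ.+ n))
    orbit-at n refl = orbit n

    avoids-neg : ∀ {N m} → BoundedFrom N (suc m) →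
      ∀ n → N ℕ.≤ n → a (1 ℕ.+ n) ≢ -[1+ m ]
    avoids-neg bnd n N≤n a≡-M = ℕ.<⇒≱
      (step-neg (a n) (bnd n N≤n) (orbit-at n a≡-M))
      (bnd (2 ℕ.+ n) (ℕ.m≤n⇒m≤o+n 2 N≤n))

    -- The value `M` at `1 + n` would force `- M` at `2 + n`, which `avoids-neg` excludes.
    avoids-pos : ∀ {N m} → BoundedFrom N (suc m) →
      ∀ n → N ℕ.≤ n → a (1 ℕ.+ n) ≢ + suc m
    avoids-pos bnd n N≤n a≡M = avoids-neg bnd (1 ℕ.+ n) (ℕ.m≤n⇒m≤1+n N≤n)
      (step-pos (a n) (bnd n N≤n) (orbit-at n a≡M)
        (bnd (2 ℕ.+ n) (ℕ.m≤n⇒m≤o+n 2 N≤n)))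

    bound-descends : ∀ {N m} → BoundedFrom N (suc m) → BoundedFrom (suc N) m
    -- Excluding an extreme value at `suc n` uses the bound at its predecessor `n`, so the tail
    -- loses one term.
    bound-descends {m = m} bnd (suc n) (ℕ.s≤s N≤n) = ℕ.≤-pred (ℕ.≤∧≢⇒<
      (bnd (suc n) (ℕ.m≤n⇒m≤1+n N≤n))
      (excluded (a (suc n)) (avoids-pos bnd n N≤n) (avoids-neg bnd n N≤n)))
      where
      excluded : ∀ i → i ≢ + suc m → i ≢ -[1+ m ] → ℤ.∣ i ∣ ≢ suc m
      excluded (+ _)    i≢M _    refl = i≢M refl
      excluded -[1+ _ ] _   i≢-M refl = i≢-M refl

    bounded⇒trivial : ∀ m N → BoundedFrom N m → EndsInTrivialCycle a
    bounded⇒trivial zero    N bnd = N , λ n N≤n → ℤ.∣i∣≡0⇒i≡0 (ℕ.n≤0⇒n≡0 (bnd n N≤n))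
    bounded⇒trivial (suc m) N bnd = bounded⇒trivial m (suc N) (bound-descends bnd)

initial-bound : ∀ (a : ℕ → ℤ) k → ∃[ m ] (∀ n → n ℕ.< k → ℤ.∣ a n ∣ ℕ.≤ m)
initial-bound a zero = 0 , λ _ ()
initial-bound a (suc k) with initial-bound a k
... | m , bnd = m ℕ.⊔ ℤ.∣ a k ∣ , λ n n<1+k → extend n (ℕ.m≤n⇒m<n∨m≡n (ℕ.≤-pred n<1+k))
  where
  extend : ∀ n → _ → ℤ.∣ a n ∣ ℕ.≤ m ℕ.⊔ ℤ.∣ a k ∣
  extend n (inj₁ n<k)  = ℕ.m≤n⇒m≤n⊔o ℤ.∣ a k ∣ (bnd n n<k)
  extend n (inj₂ refl) = ℕ.m≤n⊔m m ℤ.∣ a k ∣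

-- The maximum over the indices below `n₀ + p` bounds every term: a later index `n` has the value at
-- `n ∸ p`, which is still at least `n₀`, and strong induction applies.
periodic⇒bounded : ∀ {a} → UltimatelyPeriodic a → ∃[ m ] (∀ n → ℤ.∣ a n ∣ ℕ.≤ m)
periodic⇒bounded {a} (n₀ , p , 0<p , period) with initial-bound a (n₀ ℕ.+ p)
... | m , bnd = m , <-rec (λ n → ℤ.∣ a n ∣ ℕ.≤ m) step
  where
  step : ∀ n → (∀ {i} → i ℕ.< n → ℤ.∣ a i ∣ ℕ.≤ m) → ℤ.∣ a n ∣ ℕ.≤ m
  step n ih with n ℕ.<? n₀ ℕ.+ p
  ... | yes n<n₀+p = bnd n n<n₀+p
  ... | no  n≮n₀+p = subst (λ i → ℤ.∣ i ∣ ℕ.≤ m)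
    (trans (sym (period (n ℕ.∸ p) (ℕ.m+n≤o⇒m≤o∸n n₀ n₀+p≤n))) (cong a (ℕ.m∸n+n≡m p≤n)))
    (ih (ℕ.∸-monoʳ-< 0<p p≤n))
    where
    n₀+p≤n : n₀ ℕ.+ p ℕ.≤ n
    n₀+p≤n = ℕ.≮⇒≥ n≮n₀+p
    p≤n : p ℕ.≤ n
    p≤n = ℕ.≤-trans (ℕ.m≤n+m p n₀) n₀+p≤n

theorem4 : (λ ((r₀ , r₁) : ℝ × ℝ) → (r₀ - r₁ < - 1ℝ) × (r₀ ≥ 0ℝ)) ⊆ 𝒟₂⁽*⁾
theorem4 {r₀ , r₁} (r₀-r₁<-1 , r₀≥0) a orbit periodic =
  let m , bnd = periodic⇒bounded periodic
  in bounded⇒trivial {r₀} {r₁} r₀-r₁<-1 r₀≥0 orbit m 0 (λ n _ → bnd n)
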